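{- Let $n<\omega$, let $L\in\mathbf{M}_n$ and let $P$ be its dual $pm$-space. Then $L$ is simple if and only if $P=Q\cup\zeta(Q)$ for some order component $Q$ of $P$.
   Context: $\mathbf{M}_n$ is the variety of regular pseudocomplemented de Morgan algebras of range $n$: algebras $(L;\wedge,\vee,{}^\ast,{}^\prime,0,1)$ with bounded distributive lattice reduct, pseudocomplement ${}^\ast$, de Morgan involution ${}^\prime$, satisfying $x\wedge x^{\prime\ast\prime}\le y\vee y^\ast$ and $(x\wedge x^{\prime\ast})^{n(\prime\ast)}=(x\wedge x^{\prime\ast})^{(n+1)(\prime\ast)}$, where $x^{0(\prime\ast)}=x$, $x^{(k+1)(\prime\ast)}=((x^{k(\prime\ast)})')^\ast$. Simple algebras are non-trivial. The dual $pm$-space is the Priestley space $(P;\tau,\le)$ of prime ideals with involution $\zeta(I)=\{a:a'\notin I\}$. An order component of $P$ is a maximal subset any two elements of which are joined by a finite path in the comparability graph of $(P;\le)$. -}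

module Defs where

open import Level using (_⊔_; suc; Lift; lift; lower)
open import Algebra.Core using (Op₁; Op₂)
import Algebra.Definitions as AlgDefs
open import Algebra.Lattice.Structures using (IsDistributiveLattice)
open import Axiom.ExcludedMiddle using (ExcludedMiddle)
open import Data.Empty using (⊥-elim)
open import Data.Nat.Base as ℕ using (ℕ)
open import Data.Product.Base using (_×_; _,_; ∃-syntax; proj₁; proj₂)
open import Data.Sum.Base using (_⊎_; inj₁; inj₂; [_,_]′)
open import Function.Bundles using (_⇔_)
open import Relation.Binary.Bundles using (Poset)
open import Relation.Binary.Construct.Closure.Equivalence using (EqClosure)
open import Relation.Binary.Core using (Rel; _⇒_)
open import Relation.Binary.Structures using (IsEquivalence)
open import Relation.Nullary using (¬_; Dec; yes; no)
open import Relation.Nullary.Decidable.Core using (map′)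
open import Relation.Unary using (Pred; _∈_; _∉_; _⊆_; _≐_; Satisfiable)

-- Zorn's lemma for posets and chains of the given levels.  Together with
-- excluded middle it stands for the classical (ZFC) foundations that Priestley
-- duality relies on; Agda proves neither.
Zorn : ∀ a ℓ₁ ℓ₂ r → Set (suc (a ⊔ ℓ₁ ⊔ ℓ₂ ⊔ r))
Zorn a ℓ₁ ℓ₂ r =
  (P : Poset a ℓ₁ ℓ₂) → let open Poset P in
  ((C : Pred Carrier r) →
    (∀ {x y} → x ∈ C → y ∈ C → x ≤ y ⊎ y ≤ x) →
    ∃[ u ] (∀ {x} → x ∈ C → x ≤ u)) →
  ∃[ m ] (∀ {x} → m ≤ x → x ≈ m)

record PseudocomplementedDeMorganAlgebra c ℓ : Set (suc (c ⊔ ℓ)) where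
  infix  4 _≈_ _≤_
  infixr 7 _∧_
  infixr 6 _∨_
  infix  8 _* _′
  field
    Carrier : Set c
    _≈_     : Rel Carrier ℓ
    _∧_ _∨_ : Op₂ Carrier
    _* _′   : Op₁ Carrier
    𝟎 𝟏     : Carrier

  open AlgDefs _≈_ using (Identity; Congruent₁; Involutive)

  -- The lattice order, in the form used by Algebra.Lattice.Properties.Lattice.
  _≤_ : Rel Carrier ℓ
  x ≤ y = x ≈ x ∧ y

  field
    isDistributiveLattice : IsDistributiveLattice _≈_ _∨_ _∧_
    ∨-identity            : Identity 𝟎 _∨_
    ∧-identity            : Identity 𝟏 _∧_
    *-cong                : Congruent₁ _*
    *-pseudocomplement    : ∀ x y → (x ∧ y ≈ 𝟎) ⇔ (y ≤ x *)
    ′-cong                : Congruent₁ _′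
    ′-involutive          : Involutive _′
    ′-deMorgan            : ∀ x y → (x ∨ y) ′ ≈ x ′ ∧ y ′

  open IsDistributiveLattice isDistributiveLattice public

  -- iter′* k x is x^{k(′*)}.
  iter′* : ℕ → Op₁ Carrier
  iter′* ℕ.zero    x = x
  iter′* (ℕ.suc k) x = (iter′* k x) ′ *

infix 4 _∈𝐌_

-- L ∈𝐌 n : membership in the variety 𝐌ₙ.
record _∈𝐌_ {c ℓ} (L : PseudocomplementedDeMorganAlgebra c ℓ) (n : ℕ) :
            Set (c ⊔ ℓ) where
  open PseudocomplementedDeMorganAlgebra L
  field
    regular : ∀ x y → x ∧ x ′ * ′ ≤ y ∨ y *
    range   : ∀ x → iter′* n (x ∧ x ′ *) ≈ iter′* (ℕ.suc n) (x ∧ x ′ *)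

module _ {c ℓ} (L : PseudocomplementedDeMorganAlgebra c ℓ) where
  open PseudocomplementedDeMorganAlgebra L

  record IsCongruence {r} (θ : Rel Carrier r) : Set (c ⊔ ℓ ⊔ r) where
    open AlgDefs θ using (Congruent₁; Congruent₂)
    field
      isEquivalenceᶿ : IsEquivalence θ
      reflexiveᶿ     : _≈_ ⇒ θ
      ∧-congᶿ        : Congruent₂ _∧_
      ∨-congᶿ        : Congruent₂ _∨_
      *-congᶿ        : Congruent₁ _*
      ′-congᶿ        : Congruent₁ _′

  record IsSimple : Set (suc (c ⊔ ℓ)) where
    field
      nontrivial      : ¬ (∀ x y → x ≈ y)
      onlyCongruences : (θ : Rel Carrier (c ⊔ ℓ)) → IsCongruence θ →
                        (θ ⇒ _≈_) ⊎ (∀ x y → θ x y)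

  record PrimeIdeal : Set (suc (c ⊔ ℓ)) where
    field
      ideal       : Pred Carrier (c ⊔ ℓ)
      downClosed  : ∀ {x y} → x ≤ y → y ∈ ideal → x ∈ ideal
      𝟎-closed    : 𝟎 ∈ ideal
      ∨-closed    : ∀ {x y} → x ∈ ideal → y ∈ ideal → x ∨ y ∈ ideal
      proper      : 𝟏 ∉ ideal
      prime       : ∀ {x y} → x ∧ y ∈ ideal → x ∈ ideal ⊎ y ∈ ideal

-- The dual pm-space, as the type of prime ideals with its inclusion order and
-- the involution ζ.  The Priestley topology is left out: order components and ζ
-- do not depend on it.  Excluded middle is needed for ζ I to be prime.
module Dual {c ℓ} (em : ExcludedMiddle (suc (c ⊔ ℓ)))
            (L : PseudocomplementedDeMorganAlgebra c ℓ) where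
  open PseudocomplementedDeMorganAlgebra L
  open PrimeIdeal

  P : Set (suc (c ⊔ ℓ))
  P = PrimeIdeal L

  infix 4 _≈ᴾ_ _≤ᴾ_

  _≈ᴾ_ _≤ᴾ_ : Rel P (c ⊔ ℓ)
  I ≈ᴾ J = ideal I ≐ ideal J
  I ≤ᴾ J = ideal I ⊆ ideal J

  private
    ideal? : (I : P) (x : Carrier) → Dec (x ∈ ideal I)
    ideal? I x = map′ lower lift (em {Lift (suc (c ⊔ ℓ)) (x ∈ ideal I)})

    resp : (I : P) {x y : Carrier} → x ≈ y → y ∈ ideal I → x ∈ ideal I
    resp I {x} {y} x≈y = downClosed I (trans (sym x∧x≈x) (∧-cong refl x≈y))
      where
      x∧x≈x : x ∧ x ≈ x
      x∧x≈x = trans (∧-cong refl (sym (∨-absorbs-∧ x x))) (∧-absorbs-∨ x (x ∧ x))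

    deMorgan-∧ : ∀ x y → (x ∧ y) ′ ≈ x ′ ∨ y ′
    deMorgan-∧ x y = trans (′-cong (sym eq)) (′-involutive _)
      where
      eq : (x ′ ∨ y ′) ′ ≈ x ∧ y
      eq = trans (′-deMorgan (x ′) (y ′)) (∧-cong (′-involutive x) (′-involutive y))

    antitone : ∀ {x y} → x ≤ y → y ′ ≤ x ′
    antitone {x} {y} x≤y =
      trans (sym (∧-absorbs-∨ (y ′) (x ′)))
            (∧-cong refl (trans (∨-comm _ _)
                         (trans (sym (deMorgan-∧ x y)) (′-cong (sym x≤y)))))

    𝟏-top : ∀ x → x ≤ 𝟏
    𝟏-top x = sym (proj₂ ∧-identity x)

    𝟎-bottom : ∀ x → 𝟎 ≤ x
    𝟎-bottom x =
      trans (sym (∧-absorbs-∨ 𝟎 x)) (∧-cong refl (proj₁ ∨-identity x))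

  ζ : P → P
  ζ I = record
    { ideal      = λ a → a ′ ∉ ideal I
    ; downClosed = λ x≤y y′∉I x′∈I → y′∉I (downClosed I (antitone x≤y) x′∈I)
    ; 𝟎-closed   = λ 𝟎′∈I → proper I (resp I (sym (′-involutive 𝟏))
                     (downClosed I (antitone (𝟎-bottom (𝟏 ′))) 𝟎′∈I))
    ; ∨-closed   = λ {x} {y} x′∉I y′∉I [x∨y]′∈I →
                     [ x′∉I , y′∉I ]′
                       (prime I (resp I (sym (′-deMorgan x y)) [x∨y]′∈I))
    ; proper     = λ 𝟏′∉I → 𝟏′∉I (downClosed I (antitone (𝟏-top (𝟎 ′)))
                     (resp I (′-involutive 𝟎) (𝟎-closed I)))
    ; prime      = prime′
    }
    where
    prime′ : ∀ {x y} → (x ∧ y) ′ ∉ ideal I → x ′ ∉ ideal I ⊎ y ′ ∉ ideal I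
    prime′ {x} {y} [x∧y]′∉I with ideal? I (x ′) | ideal? I (y ′)
    ... | no x′∉I  | _         = inj₁ x′∉I
    ... | yes _    | no y′∉I   = inj₂ y′∉I
    ... | yes x′∈I | yes y′∈I  =
      ⊥-elim ([x∧y]′∉I (resp I (deMorgan-∧ x y) (∨-closed I x′∈I y′∈I)))

  -- Direct image of a set of points; points are compared by _≈ᴾ_.
  ζ[_] : ∀ {r} → Pred P r → Pred P (suc (c ⊔ ℓ) ⊔ r)
  ζ[ Q ] J = ∃[ I ] (I ∈ Q × J ≈ᴾ ζ I)

  -- EqClosure _≤ᴾ_ I J is the existence of a finite path from I to J in the
  -- comparability graph of P.
  PathConnected : ∀ {r} → Pred P r → Set (suc (c ⊔ ℓ) ⊔ r)
  PathConnected Q = ∀ {I J} → I ∈ Q → J ∈ Q → EqClosure _≤ᴾ_ I J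

  -- Nonemptiness only matters when P is empty (that is, L is trivial): it keeps
  -- the empty set from being an order component.
  record IsOrderComponent (Q : Pred P (suc (c ⊔ ℓ))) : Set (suc (suc (c ⊔ ℓ))) where
    field
      nonempty  : Satisfiable Q
      connected : PathConnected Q
      maximal   : (R : Pred P (suc (c ⊔ ℓ))) → PathConnected R → Q ⊆ R → R ⊆ Q

{-# OPTIONS --safe #-}

-- Write d x for x′*.  By the range condition, z = dⁿ (x ∧ d x) is a fixed point of
-- d, and {(a , b) : a ∧ z ≈ b ∧ z} is then a congruence.  By regularity a
-- congruence whose class of 𝟏 is trivial is the identity.  Hence L is simple iff it
-- is non-trivial and dⁿ (x ∧ d x) ≈ 𝟎 for every x other than 𝟏.
--
-- Dually, a fixed point z of d is complemented with complement z′, so the set of prime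
-- ideals containing it is a union of order components invariant under ζ; if
-- P = Q ∪ ζ(Q), only 𝟎 and 𝟏 can be fixed.  Conversely, d x ∈ I iff x lies in some
-- prime ideal J ⊇ ζ I, so dᵏ x ∈ I iff x lies in a prime ideal reached from I by k
-- steps I ↦ J ⊇ ζ I.  As d preserves meets, dⁿ (x ∧ d x) ≈ 𝟎 puts dⁿ x or dⁿ⁺¹ x in
-- I; for all x in a prime ideal K at once, this yields (by compactness) a prime ideal
-- above K reached from I by n or n + 1 steps, so K is connected to I or to ζ I.
module Submission where

open import Level using (_⊔_; suc; Lift; lift; lower)
import Algebra.Lattice.Properties.Lattice as LatticeProperties
open import Axiom.ExcludedMiddle using (ExcludedMiddle)
open import Data.Empty using (⊥-elim)
open import Data.Nat.Base as ℕ using (ℕ)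
open import Data.Product.Base using (_×_; _,_; ∃-syntax; proj₁; proj₂)
open import Data.Sum.Base as Sum using (_⊎_; inj₁; inj₂; [_,_]′)
open import Function.Base using (_∘_; id)
open import Function.Bundles using (_⇔_; mk⇔; Equivalence)
open import Function.Properties.Equivalence using (⇔-isEquivalence)
  renaming (trans to ⇔-trans)
open import Relation.Binary.Bundles using (Poset)
open import Relation.Binary.Construct.Closure.Equivalence
  using (EqClosure; gfold; return; symmetric; transitive)
import Relation.Binary.Construct.Closure.Equivalence as EqClosure
import Relation.Binary.Construct.On as On
open import Relation.Binary.Core using (Rel; _⇒_)
import Relation.Binary.Lattice as Order
import Relation.Binary.Lattice.Properties.JoinSemilattice as JoinProperties
import Relation.Binary.Lattice.Properties.MeetSemilattice as MeetProperties
open import Relation.Binary.PropositionalEquality as ≡ using (_≡_)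
open import Relation.Binary.Structures using (IsEquivalence)
open import Relation.Nullary using (¬_; Dec; yes; no; contradiction)
open import Relation.Nullary.Decidable
  using (True; decidable-stable; toWitness; fromWitness; map′)
open import Relation.Unary using (Pred; U; _∪_; _≐_; _∈_; _∉_; _⊆_)
open import Relation.Unary.Relation.Binary.Subset using (⊆-poset)
open import Defs

-- Arithmetic of `*`, `′` and the iterates of `′*`.

module AlgebraProperties {c ℓ} (L : PseudocomplementedDeMorganAlgebra c ℓ) where
  open PseudocomplementedDeMorganAlgebra L

  private
    orderLattice : Order.Lattice c ℓ ℓ
    orderLattice =
      LatticeProperties.∨-∧-orderTheoreticLattice record { isLattice = isLattice }

  open Order.Lattice orderLattice public
    using (x≤x∨y; y≤x∨y; ∨-least; x∧y≤x; x∧y≤y; ∧-greatest; antisym)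
    renaming (refl to ≤-refl; trans to ≤-trans; reflexive to ≤-reflexive)
  open MeetProperties (Order.Lattice.meetSemilattice orderLattice) public
    using (∧-monotonic)
  open JoinProperties (Order.Lattice.joinSemilattice orderLattice) public
    using (∨-monotonic)

  ≤-𝟏 : ∀ x → x ≤ 𝟏
  ≤-𝟏 x = sym (proj₂ ∧-identity x)

  𝟎-≤ : ∀ x → 𝟎 ≤ x
  𝟎-≤ x = ≤-trans (x≤x∨y 𝟎 x) (≤-reflexive (proj₁ ∨-identity x))

  ≤𝟎⇒≈𝟎 : ∀ {x} → x ≤ 𝟎 → x ≈ 𝟎
  ≤𝟎⇒≈𝟎 x≤𝟎 = antisym x≤𝟎 (𝟎-≤ _)

  𝟏≤⇒≈𝟏 : ∀ {x} → 𝟏 ≤ x → x ≈ 𝟏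
  𝟏≤⇒≈𝟏 𝟏≤x = antisym (≤-𝟏 _) 𝟏≤x

  ∧-distribˡ-∨-≤ : ∀ {u x y} → u ∧ (x ∨ y) ≤ u ∧ x ∨ u ∧ y
  ∧-distribˡ-∨-≤ = ≤-reflexive (∧-distribˡ-∨ _ _ _)

  ∨-elim-≤ : ∀ {u v x y} → u ≤ x ∨ y → u ∧ x ≤ v → u ∧ y ≤ v → u ≤ v
  ∨-elim-≤ u≤x∨y u∧x≤v u∧y≤v =
    ≤-trans (∧-greatest ≤-refl u≤x∨y)
      (≤-trans ∧-distribˡ-∨-≤ (∨-least u∧x≤v u∧y≤v))

  ∧-swap-≤ : ∀ {x y} → x ∧ y ≤ y ∧ x
  ∧-swap-≤ = ≤-reflexive (∧-comm _ _)

  ∨-swap-≤ : ∀ {x y} → x ∨ y ≤ y ∨ x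
  ∨-swap-≤ = ≤-reflexive (∨-comm _ _)

  disjoint⇒≤* : ∀ {x y} → x ∧ y ≤ 𝟎 → y ≤ x *
  disjoint⇒≤* x∧y≤𝟎 = Equivalence.to (*-pseudocomplement _ _) (≤𝟎⇒≈𝟎 x∧y≤𝟎)

  ≤*⇒disjoint : ∀ {x y} → y ≤ x * → x ∧ y ≤ 𝟎
  ≤*⇒disjoint y≤x* = ≤-reflexive (Equivalence.from (*-pseudocomplement _ _) y≤x*)

  x∧x*≤𝟎 : ∀ {x} → x ∧ x * ≤ 𝟎
  x∧x*≤𝟎 = ≤*⇒disjoint ≤-refl

  *-antitone : ∀ {x y} → x ≤ y → y * ≤ x *
  *-antitone x≤y = disjoint⇒≤* (≤-trans (∧-monotonic x≤y ≤-refl) x∧x*≤𝟎)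

  x≤x** : ∀ {x} → x ≤ x * *
  x≤x** = disjoint⇒≤* (≤-trans ∧-swap-≤ x∧x*≤𝟎)

  ′-antitone : ∀ {x y} → x ≤ y → y ′ ≤ x ′
  ′-antitone {x} {y} x≤y = ≤-trans
    (≤-reflexive (trans (′-cong (antisym (y≤x∨y x y) (∨-least x≤y ≤-refl))) (′-deMorgan x y)))
    (x∧y≤x _ _)

  x≤x′′ : ∀ {x} → x ≤ x ′ ′
  x≤x′′ = ≤-reflexive (sym (′-involutive _))

  x′′≤x : ∀ {x} → x ′ ′ ≤ x
  x′′≤x = ≤-reflexive (′-involutive _)

  ∧-deMorgan-≤ : ∀ {x y} → (x ∧ y) ′ ≤ x ′ ∨ y ′
  ∧-deMorgan-≤ {x} {y} = ≤-trans (′-antitone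
    (≤-trans (≤-reflexive (′-deMorgan (x ′) (y ′))) (∧-monotonic x′′≤x x′′≤x))) x′′≤x

  𝟏≤𝟎′ : 𝟏 ≤ 𝟎 ′
  𝟏≤𝟎′ = ≤-trans x≤x′′ (′-antitone (𝟎-≤ _))

  𝟏′≤𝟎 : 𝟏 ′ ≤ 𝟎
  𝟏′≤𝟎 = ≤-trans (′-antitone (≤-𝟏 _)) x′′≤x

  𝟏≤𝟎* : 𝟏 ≤ 𝟎 *
  𝟏≤𝟎* = disjoint⇒≤* (x∧y≤x _ _)

  ′*-monotone : ∀ {x y} → x ≤ y → x ′ * ≤ y ′ *
  ′*-monotone = *-antitone ∘ ′-antitone

  ′*-∧ : ∀ {x y} → x ′ * ∧ y ′ * ≤ (x ∧ y) ′ *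
  ′*-∧ = disjoint⇒≤* (≤-trans (∧-monotonic ∧-deMorgan-≤ ≤-refl) (≤-trans ∧-swap-≤
    (≤-trans ∧-distribˡ-∨-≤ (∨-least
      (≤-trans (∧-monotonic (x∧y≤x _ _) ≤-refl) (≤-trans ∧-swap-≤ x∧x*≤𝟎))
      (≤-trans (∧-monotonic (x∧y≤y _ _) ≤-refl) (≤-trans ∧-swap-≤ x∧x*≤𝟎))))))

  disjoint⇒′-cover : ∀ {x y} → x ∧ y ≤ 𝟎 → 𝟏 ≤ x ′ ∨ y ′
  disjoint⇒′-cover x∧y≤𝟎 = ≤-trans 𝟏≤𝟎′ (≤-trans (′-antitone x∧y≤𝟎) ∧-deMorgan-≤)

  𝟏≤x∨x′*′ : ∀ {x} → 𝟏 ≤ x ∨ x ′ * ′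
  𝟏≤x∨x′*′ = ≤-trans (disjoint⇒′-cover x∧x*≤𝟎) (∨-monotonic x′′≤x ≤-refl)

  -- `x ′ * ′` joins with `x` to `𝟏`, so anything disjoint from it, in particular its
  -- pseudocomplement, lies below `x`.
  ′*′*-≤ : ∀ {x} → x ′ * ′ * ≤ x
  ′*′*-≤ = ∨-elim-≤ (≤-trans (≤-𝟏 _) 𝟏≤x∨x′*′) (x∧y≤y _ _)
    (≤-trans (≤-trans ∧-swap-≤ x∧x*≤𝟎) (𝟎-≤ _))

  -- `iter′*` adds each new application on the outside; this exposes the innermost one, where the
  -- later arguments about `x` and `x ′ *` take place.
  iter′*-shift : ∀ k x → iter′* (ℕ.suc k) x ≡ iter′* k (x ′ *)
  iter′*-shift ℕ.zero    x = ≡.refl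
  iter′*-shift (ℕ.suc k) x = ≡.cong (λ y → y ′ *) (iter′*-shift k x)

  iter′*-monotone : ∀ k {x y} → x ≤ y → iter′* k x ≤ iter′* k y
  iter′*-monotone ℕ.zero    x≤y = x≤y
  iter′*-monotone (ℕ.suc k) x≤y = ′*-monotone (iter′*-monotone k x≤y)

  iter′*-∧ : ∀ k {x y} → iter′* k x ∧ iter′* k y ≤ iter′* k (x ∧ y)
  iter′*-∧ ℕ.zero    = ≤-refl
  iter′*-∧ (ℕ.suc k) = ≤-trans ′*-∧ (′*-monotone (iter′*-∧ k))

  -- The meet forces descent: `′*` sends the factor `x ′ *` below `x` by `′*′*-≤`, and the factor
  -- `x` to `x ′ *`.
  ∧′*-deflationary : ∀ {x} → (x ∧ x ′ *) ′ * ≤ x ∧ x ′ *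
  ∧′*-deflationary = ∧-greatest
    (≤-trans (′*-monotone (x∧y≤y _ _)) ′*′*-≤)
    (′*-monotone (x∧y≤x _ _))

  iter′*-deflationary : ∀ k {x} → x ′ * ≤ x → iter′* k x ≤ x
  iter′*-deflationary ℕ.zero    x′*≤x = ≤-refl
  iter′*-deflationary (ℕ.suc k) x′*≤x =
    ≤-trans (′*-monotone (iter′*-deflationary k x′*≤x)) x′*≤x

  iter′*-∧′*-≤ : ∀ n {x} → iter′* n (x ∧ x ′ *) ≤ x
  iter′*-∧′*-≤ n = ≤-trans (iter′*-deflationary n ∧′*-deflationary) (x∧y≤x _ _)

  fixed⇒disjoint : ∀ {z} → z ≈ z ′ * → z ∧ z ′ ≤ 𝟎
  fixed⇒disjoint z≈z′* = ≤-trans ∧-swap-≤ (≤*⇒disjoint (≤-reflexive z≈z′*))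

  fixed⇒cover : ∀ {z} → z ≈ z ′ * → 𝟏 ≤ z ∨ z ′
  fixed⇒cover z≈z′* = ≤-trans (disjoint⇒′-cover (fixed⇒disjoint z≈z′*))
    (≤-trans ∨-swap-≤ (∨-monotonic x′′≤x ≤-refl))

  Regular : Set (c ⊔ ℓ)
  Regular = ∀ x y → x ∧ x ′ * ′ ≤ y ∨ y *

  -- Cover `x` by `y` and `y ′ * ′`. The second part lies below `x ∧ x ′ * ′`, so regularity splits
  -- it along `y` and `y *`; what falls under `y *` lies below `x ∧ x *`.
  regular-≤ : Regular → ∀ {x y} → y * ≤ x * → x ′ * ≤ y ′ * → x ≤ y
  regular-≤ reg {x} {y} y*≤x* x′*≤y′* =
    ∨-elim-≤ (≤-trans (≤-𝟏 _) 𝟏≤x∨x′*′) (x∧y≤y _ _)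
      (∨-elim-≤
        (≤-trans (∧-monotonic ≤-refl (′-antitone x′*≤y′*)) (reg x y))
        (x∧y≤y _ _)
        (≤-trans (∧-monotonic (x∧y≤x _ _) y*≤x*) (≤-trans x∧x*≤𝟎 (𝟎-≤ _))))

  -- Congruences, their classes of `𝟏`, and the congruence of a fixed point.

  module CongruenceProperties {r} {θ : Rel Carrier r} (isCongruence : IsCongruence L θ) where
    open IsCongruence isCongruence
    open IsEquivalence isEquivalenceᶿ
      renaming (refl to reflᶿ; sym to symᶿ; trans to transᶿ)

    Trivial𝟏-Class : Set (c ⊔ ℓ ⊔ r)
    Trivial𝟏-Class = ∀ {x} → θ x 𝟏 → x ≈ 𝟏

    iter′*-𝟏-class : ∀ k {x} → θ x 𝟏 → θ (iter′* k x) 𝟏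
    iter′*-𝟏-class ℕ.zero    θx𝟏 = θx𝟏
    iter′*-𝟏-class (ℕ.suc k) θx𝟏 =
      transᶿ (*-congᶿ (′-congᶿ (iter′*-𝟏-class k θx𝟏)))
        (reflexiveᶿ (𝟏≤⇒≈𝟏 (≤-trans 𝟏≤𝟎* (*-antitone 𝟏′≤𝟎))))

    ∧′*-𝟏-class : ∀ {x} → θ x 𝟏 → θ (x ∧ x ′ *) 𝟏
    ∧′*-𝟏-class θx𝟏 = transᶿ (∧-congᶿ θx𝟏 (iter′*-𝟏-class 1 θx𝟏))
      (reflexiveᶿ (proj₁ ∧-identity 𝟏))

    total : θ 𝟎 𝟏 → ∀ x y → θ x y
    total θ𝟎𝟏 x y = transᶿ (collapse x) (symᶿ (collapse y))
      where
      collapse : ∀ x → θ x 𝟎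
      collapse x = transᶿ (reflexiveᶿ (≤-𝟏 x))
        (transᶿ (∧-congᶿ reflᶿ (symᶿ θ𝟎𝟏)) (reflexiveᶿ (≤𝟎⇒≈𝟎 (x∧y≤y _ _))))

    -- The 𝟏-class contains (x* ∧ y**)*, which is 𝟏 exactly when x* ≤ y*.
    *-≤ : Trivial𝟏-Class → ∀ {x y} → θ x y → x * ≤ y *
    *-≤ trivial {x} {y} θxy =
      ≤-trans (disjoint⇒≤* (≤-trans ∧-swap-≤ x*∧y**≤𝟎)) (*-antitone x≤x**)
      where
      [x*∧y**]*≈𝟏 : (x * ∧ y * *) * ≈ 𝟏
      [x*∧y**]*≈𝟏 = trivial (transᶿ (*-congᶿ (∧-congᶿ (*-congᶿ θxy) reflᶿ))
        (reflexiveᶿ (𝟏≤⇒≈𝟏 (≤-trans 𝟏≤𝟎* (*-antitone x∧x*≤𝟎)))))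

      x*∧y**≤𝟎 : x * ∧ y * * ≤ 𝟎
      x*∧y**≤𝟎 = ≤-trans (∧-greatest ≤-refl (≤-𝟏 _))
        (≤*⇒disjoint (≤-reflexive (sym [x*∧y**]*≈𝟏)))

    regular⇒identity : Regular → Trivial𝟏-Class → θ ⇒ _≈_
    regular⇒identity reg trivial θxy = antisym (below θxy) (below (symᶿ θxy))
      where
      below : ∀ {x y} → θ x y → x ≤ y
      below θxy = regular-≤ reg (*-≤ trivial (symᶿ θxy)) (*-≤ trivial (′-congᶿ θxy))

  -- The Lift only moves the relation to the level at which simplicity tests congruences.
  _≈[_]_ : Carrier → Carrier → Carrier → Set (c ⊔ ℓ)
  x ≈[ z ] y = Lift c (x ∧ z ≈ y ∧ z)

  fixed⇒isCongruence : ∀ {z} → z ≈ z ′ * → IsCongruence L (_≈[ z ]_)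
  fixed⇒isCongruence {z} z≈z′* = record
    { isEquivalenceᶿ = record
      { refl  = lift refl
      ; sym   = lift ∘ sym ∘ lower
      ; trans = λ (lift p) (lift q) → lift (trans p q)
      }
    ; reflexiveᶿ = λ x≈y → lift (∧-cong x≈y refl)
    ; ∧-congᶿ = λ (lift p) (lift q) → lift (antisym (∧-≤ p q) (∧-≤ (sym p) (sym q)))
    ; ∨-congᶿ = λ (lift p) (lift q) →
        lift (trans (∧-distribʳ-∨ _ _ _) (trans (∨-cong p q) (sym (∧-distribʳ-∨ _ _ _))))
    ; *-congᶿ = λ (lift p) → lift (antisym (*-≤ p) (*-≤ (sym p)))
    ; ′-congᶿ = λ (lift p) → lift (antisym (′-≤ p) (′-≤ (sym p)))
    }
    where
    below : ∀ {x y} → x ∧ z ≈ y ∧ z → x ∧ z ≤ y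
    below p = ≤-trans (≤-reflexive p) (x∧y≤x _ _)

    ∧-≤ : ∀ {x y u v} → x ∧ z ≈ y ∧ z → u ∧ z ≈ v ∧ z → (x ∧ u) ∧ z ≤ (y ∧ v) ∧ z
    ∧-≤ p q = ∧-greatest (∧-greatest
      (≤-trans (∧-monotonic (x∧y≤x _ _) ≤-refl) (below p))
      (≤-trans (∧-monotonic (x∧y≤y _ _) ≤-refl) (below q))) (x∧y≤y _ _)

    -- `y` meets `x * ∧ z` inside `y ∧ z`, hence inside `x`, which is disjoint from `x *`.
    *-≤ : ∀ {x y} → x ∧ z ≈ y ∧ z → x * ∧ z ≤ y * ∧ z
    *-≤ p = ∧-greatest
      (disjoint⇒≤* (≤-trans
        (∧-greatest
          (≤-trans (∧-greatest (x∧y≤x _ _) (≤-trans (x∧y≤y _ _) (x∧y≤y _ _))) (below (sym p)))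
          (≤-trans (x∧y≤y _ _) (x∧y≤x _ _)))
        x∧x*≤𝟎))
      (x∧y≤y _ _)

    -- x ∧ z ≤ y gives y′ ≤ x′ ∨ z′, and z′ is disjoint from z.
    ′-≤ : ∀ {x y} → x ∧ z ≈ y ∧ z → x ′ ∧ z ≤ y ′ ∧ z
    ′-≤ p = ∧-greatest
      (∨-elim-≤
        (≤-trans (x∧y≤x _ _) (≤-trans (′-antitone (below (sym p))) ∧-deMorgan-≤))
        (x∧y≤y _ _)
        (≤-trans (∧-monotonic (x∧y≤y _ _) ≤-refl)
          (≤-trans (fixed⇒disjoint z≈z′*) (𝟎-≤ _))))
      (x∧y≤y _ _)

  -- The congruence always relates `z` to `𝟏`, so being the identity forces `z ≈ 𝟏`; if it is total,
  -- comparing `𝟏` with `𝟎` forces `z ≈ 𝟎`.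
  fixed-simple : IsSimple L → ∀ {z} → z ≈ z ′ * → z ≈ 𝟏 ⊎ z ≈ 𝟎
  fixed-simple simple {z} z≈z′* =
    Sum.map
      (λ identity → identity (lift (antisym
        (∧-monotonic (≤-𝟏 z) ≤-refl) (∧-greatest (x∧y≤y _ _) (x∧y≤y _ _)))))
      (λ total → ≤𝟎⇒≈𝟎 (≤-trans (∧-greatest (≤-𝟏 z) ≤-refl)
        (≤-trans (≤-reflexive (lower (total 𝟏 𝟎))) (x∧y≤x _ _))))
      (IsSimple.onlyCongruences simple (_≈[ z ]_) (fixed⇒isCongruence z≈z′*))

  -- The iterate is a fixed point below `x`, so it can be `𝟏` only when `x` is.
  ∧′*-simple : IsSimple L → ∀ {n} → L ∈𝐌 n → ∀ {x} → ¬ x ≈ 𝟏 →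
               iter′* n (x ∧ x ′ *) ≈ 𝟎
  ∧′*-simple simple {n} L∈𝐌 x≉𝟏 with fixed-simple simple (_∈𝐌_.range L∈𝐌 _)
  ... | inj₂ ≈𝟎 = ≈𝟎
  ... | inj₁ ≈𝟏 =
    contradiction (𝟏≤⇒≈𝟏 (≤-trans (≤-reflexive (sym ≈𝟏)) (iter′*-∧′*-≤ n))) x≉𝟏

-- The prime ideal theorem, from Zorn's lemma.

module PrimeIdealTheorem {c ℓ} (em : ExcludedMiddle (suc (c ⊔ ℓ)))
    (zorn : Zorn (suc (c ⊔ ℓ)) (c ⊔ ℓ) (c ⊔ ℓ) (suc (c ⊔ ℓ)))
    (L : PseudocomplementedDeMorganAlgebra c ℓ) where
  open PseudocomplementedDeMorganAlgebra L
  open AlgebraProperties L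

  decide : (A : Set (c ⊔ ℓ)) → Dec A
  decide A = map′ lower lift (em {Lift (suc (c ⊔ ℓ)) A})

  -- Excluded middle makes propositions of the larger level equivalent to ones of the
  -- smaller level, so that the union of a chain of ideals is again an ideal of level c ⊔ ℓ.
  Resize : Set (suc (c ⊔ ℓ)) → Set (c ⊔ ℓ)
  Resize A = Lift (c ⊔ ℓ) (True (em {A}))

  resize : ∀ {A} → A → Resize A
  resize a = lift (fromWitness a)

  unresize : ∀ {A} → Resize A → A
  unresize (lift t) = toWitness t

  record IsIdeal {r} (K : Pred Carrier r) : Set (c ⊔ ℓ ⊔ r) where
    field
      downClosed : ∀ {x y} → x ≤ y → y ∈ K → x ∈ K
      𝟎-closed   : 𝟎 ∈ K
      ∨-closed   : ∀ {x y} → x ∈ K → y ∈ K → x ∨ y ∈ K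

  prime⇒isIdeal : (I : PrimeIdeal L) → IsIdeal (PrimeIdeal.ideal I)
  prime⇒isIdeal I = record { PrimeIdeal I }

  ↓ : Carrier → Pred Carrier (c ⊔ ℓ)
  ↓ x a = Lift c (a ≤ x)

  ↓-isIdeal : ∀ x → IsIdeal (↓ x)
  ↓-isIdeal x = record
    { downClosed = λ a≤b (lift b≤x) → lift (≤-trans a≤b b≤x)
    ; 𝟎-closed   = lift (𝟎-≤ x)
    ; ∨-closed   = λ (lift a≤x) (lift b≤x) → lift (∨-least a≤x b≤x)
    }

  infixr 6 _∨ᴵ_

  -- The join in the lattice of ideals.
  _∨ᴵ_ : (H K : Pred Carrier (c ⊔ ℓ)) → Pred Carrier (c ⊔ ℓ)
  (H ∨ᴵ K) a = ∃[ h ] ∃[ k ] (h ∈ H × k ∈ K × a ≤ h ∨ k)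

  module _ {H K : Pred Carrier (c ⊔ ℓ)} (isIdealH : IsIdeal H) (isIdealK : IsIdeal K) where
    private
      module H = IsIdeal isIdealH
      module K = IsIdeal isIdealK

    ∨ᴵ-isIdeal : IsIdeal (H ∨ᴵ K)
    ∨ᴵ-isIdeal = record
      { downClosed = λ x≤y (h , k , h∈H , k∈K , y≤h∨k) →
          h , k , h∈H , k∈K , ≤-trans x≤y y≤h∨k
      ; 𝟎-closed = 𝟎 , 𝟎 , H.𝟎-closed , K.𝟎-closed , 𝟎-≤ _
      ; ∨-closed = λ (h , k , h∈H , k∈K , x≤h∨k) (h′ , k′ , h′∈H , k′∈K , y≤h′∨k′) →
          h ∨ h′ , k ∨ k′ , H.∨-closed h∈H h′∈H , K.∨-closed k∈K k′∈K ,
          ∨-least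
            (≤-trans x≤h∨k (∨-monotonic (x≤x∨y _ _) (x≤x∨y _ _)))
            (≤-trans y≤h′∨k′ (∨-monotonic (y≤x∨y _ _) (y≤x∨y _ _)))
      }

    ⊆-∨ᴵˡ : H ⊆ H ∨ᴵ K
    ⊆-∨ᴵˡ h∈H = _ , 𝟎 , h∈H , K.𝟎-closed , x≤x∨y _ _

    ⊆-∨ᴵʳ : K ⊆ H ∨ᴵ K
    ⊆-∨ᴵʳ k∈K = 𝟎 , _ , H.𝟎-closed , k∈K , y≤x∨y _ _

  module _ {K : Pred Carrier (c ⊔ ℓ)} (isIdealK : IsIdeal K) (𝟏∉K : 𝟏 ∉ K) where
    private
      record ProperExtension : Set (suc (c ⊔ ℓ)) where
        field
          ideal   : Pred Carrier (c ⊔ ℓ)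
          isIdeal : IsIdeal ideal
          proper  : 𝟏 ∉ ideal
          extends : K ⊆ ideal
        open IsIdeal isIdeal public

      open ProperExtension

      extensions : Poset _ _ _
      extensions = On.poset (⊆-poset Carrier (c ⊔ ℓ)) ideal

      module _ (C : Pred ProperExtension (suc (c ⊔ ℓ)))
               (chain : ∀ {H J} → H ∈ C → J ∈ C → ideal H ⊆ ideal J ⊎ ideal J ⊆ ideal H) where

        -- K is included for the sake of the empty chain.
        Union : Pred Carrier (suc (c ⊔ ℓ))
        Union a = a ∈ K ⊎ ∃[ H ] (H ∈ C × a ∈ ideal H)

        union-∨ : ∀ {x y} → x ∈ Union → y ∈ Union → x ∨ y ∈ Union
        union-∨ (inj₁ x∈K) (inj₁ y∈K) = inj₁ (IsIdeal.∨-closed isIdealK x∈K y∈K)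
        union-∨ (inj₁ x∈K) (inj₂ (J , J∈C , y∈J)) =
          inj₂ (J , J∈C , ∨-closed J (extends J x∈K) y∈J)
        union-∨ (inj₂ (H , H∈C , x∈H)) (inj₁ y∈K) =
          inj₂ (H , H∈C , ∨-closed H x∈H (extends H y∈K))
        union-∨ (inj₂ (H , H∈C , x∈H)) (inj₂ (J , J∈C , y∈J)) with chain H∈C J∈C
        ... | inj₁ H⊆J = inj₂ (J , J∈C , ∨-closed J (H⊆J x∈H) y∈J)
        ... | inj₂ J⊆H = inj₂ (H , H∈C , ∨-closed H x∈H (J⊆H y∈J))

        union : ProperExtension
        union = record
          { ideal   = Resize ∘ Union
          ; isIdeal = record
            { downClosed = λ x≤y → resize ∘
                Sum.map (IsIdeal.downClosed isIdealK x≤y)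
                        (λ (H , H∈C , y∈H) → H , H∈C , downClosed H x≤y y∈H) ∘ unresize
            ; 𝟎-closed   = resize (inj₁ (IsIdeal.𝟎-closed isIdealK))
            ; ∨-closed   = λ x∈ y∈ → resize (union-∨ (unresize x∈) (unresize y∈))
            }
          ; proper  = [ 𝟏∉K , (λ (H , _ , 𝟏∈H) → proper H 𝟏∈H) ]′ ∘ unresize
          ; extends = resize ∘ inj₁
          }

      maximalExtension : ∃[ M ] (∀ {H} → ideal M ⊆ ideal H → ideal H ≐ ideal M)
      maximalExtension = zorn extensions λ C chain →
        union C chain , λ {H} H∈C x∈H → resize (inj₂ (H , H∈C , x∈H))

      M : ProperExtension
      M = proj₁ maximalExtension

      -- Otherwise adjoining `x` would give a proper ideal above `M`, and maximality would put `x`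
      -- back into `M`.
      maximal : ∀ {x} → x ∉ ideal M → 𝟏 ∈ ideal M ∨ᴵ ↓ x
      maximal {x} x∉M with decide (𝟏 ∈ ideal M ∨ᴵ ↓ x)
      ... | yes 𝟏∈M∨x = 𝟏∈M∨x
      ... | no 𝟏∉M∨x = contradiction (proj₁ (proj₂ maximalExtension {M∨x} M⊆M∨x) x∈M∨x) x∉M
        where
        M⊆M∨x : ideal M ⊆ ideal M ∨ᴵ ↓ x
        M⊆M∨x = ⊆-∨ᴵˡ (isIdeal M) (↓-isIdeal x)

        x∈M∨x : x ∈ ideal M ∨ᴵ ↓ x
        x∈M∨x = ⊆-∨ᴵʳ (isIdeal M) (↓-isIdeal x) (lift ≤-refl)

        M∨x : ProperExtension
        M∨x = record
          { isIdeal = ∨ᴵ-isIdeal (isIdeal M) (↓-isIdeal x)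
          ; proper  = 𝟏∉M∨x
          ; extends = M⊆M∨x ∘ extends M
          }

      -- If neither factor is in `M`, adjoining either one reaches `𝟏`. By distributivity so does
      -- adjoining `x ∧ y`, which is already in `M`.
      maximal-prime : ∀ {x y} → x ∧ y ∈ ideal M → x ∈ ideal M ⊎ y ∈ ideal M
      maximal-prime {x} {y} x∧y∈M with decide (x ∈ ideal M) | decide (y ∈ ideal M)
      ... | yes x∈M | _       = inj₁ x∈M
      ... | no _    | yes y∈M = inj₂ y∈M
      ... | no x∉M  | no y∉M
        with h , _ , h∈M , lift a≤x , 𝟏≤h∨a ← maximal x∉M
           | k , _ , k∈M , lift b≤y , 𝟏≤k∨b ← maximal y∉M =
        ⊥-elim (proper M (downClosed M 𝟏≤ (∨-closed M (∨-closed M h∈M k∈M) x∧y∈M)))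
        where
        𝟏≤ : 𝟏 ≤ (h ∨ k) ∨ (x ∧ y)
        𝟏≤ = ≤-trans
          (∧-greatest
            (≤-trans 𝟏≤h∨a (∨-monotonic (x≤x∨y h k) a≤x))
            (≤-trans 𝟏≤k∨b (∨-monotonic (y≤x∨y h k) b≤y)))
          (≤-reflexive (sym (∨-distribˡ-∧ (h ∨ k) x y)))

    extendToPrime : ∃[ J ] K ⊆ PrimeIdeal.ideal {L = L} J
    extendToPrime = record { ProperExtension M ; prime = maximal-prime } , extends M

-- Order components of the dual space and the involution `ζ`.

module DualProperties {c ℓ} (em : ExcludedMiddle (suc (c ⊔ ℓ)))
    (zorn : Zorn (suc (c ⊔ ℓ)) (c ⊔ ℓ) (c ⊔ ℓ) (suc (c ⊔ ℓ)))
    (L : PseudocomplementedDeMorganAlgebra c ℓ) where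
  open PseudocomplementedDeMorganAlgebra L
  open AlgebraProperties L
  open PrimeIdealTheorem em zorn L
  open Dual em L
  open PrimeIdeal {L = L}

  infix 4 _~_

  _~_ : Rel P (suc (c ⊔ ℓ))
  _~_ = EqClosure _≤ᴾ_

  ~-sym : ∀ {I J} → I ~ J → J ~ I
  ~-sym = symmetric _≤ᴾ_

  ~-trans : ∀ {I J K} → I ~ J → J ~ K → I ~ K
  ~-trans = transitive _≤ᴾ_

  ≤⇒~ : ∀ I J → I ≤ᴾ J → I ~ J
  ≤⇒~ I J I⊆J = return {R = _≤ᴾ_} {x = I} {y = J} I⊆J

  ζ-antitone : ∀ I J → I ≤ᴾ J → ζ J ≤ᴾ ζ I
  ζ-antitone I J I⊆J a′∉J a′∈I = a′∉J (I⊆J a′∈I)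

  -- `ζ` reverses every edge of a path, and paths ignore direction.
  ζ-~ : ∀ {I J} → I ~ J → ζ I ~ ζ J
  ζ-~ = gfold {R = _≤ᴾ_} (EqClosure.isEquivalence _≤ᴾ_) ζ λ {I} {J} I⊆J →
    ~-sym (≤⇒~ (ζ J) (ζ I) (ζ-antitone I J I⊆J))

  ζ-involutive : ∀ I → I ≈ᴾ ζ (ζ I)
  ζ-involutive I =
    (λ a∈I a′′∉I → a′′∉I (downClosed I x′′≤x a∈I)) ,
    λ {a} ¬a′′∉I → downClosed I x≤x′′ (decidable-stable (decide _) ¬a′′∉I)

  ~-ζζ : ∀ I → I ~ ζ (ζ I)
  ~-ζζ I = ≤⇒~ I (ζ (ζ I)) (proj₁ (ζ-involutive I))

  component : P → Pred P (suc (c ⊔ ℓ))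
  component I J = I ~ J

  component-isOrderComponent : ∀ I → IsOrderComponent (component I)
  component-isOrderComponent I = record
    { nonempty  = I , EqClosure.reflexive _≤ᴾ_
    ; connected = λ I~J I~K → ~-trans (~-sym I~J) I~K
    ; maximal   = λ R connected component⊆R →
        connected (component⊆R (EqClosure.reflexive _≤ᴾ_))
    }

  -- Fixed points of `′*` in prime ideals.

  module _ {z} (z≈z′* : z ≈ z ′ *) where

    fixed-∉⇒′-∈ : ∀ I → z ∉ ideal I → z ′ ∈ ideal I
    fixed-∉⇒′-∈ I z∉I =
      [ (λ z∈I → contradiction z∈I z∉I) , id ]′
        (prime I (downClosed I (fixed⇒disjoint z≈z′*) (𝟎-closed I)))

    fixed-∈⇒′-∉ : ∀ I → z ∈ ideal I → z ′ ∉ ideal I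
    fixed-∈⇒′-∉ I z∈I z′∈I =
      proper I (downClosed I (fixed⇒cover z≈z′*) (∨-closed I z∈I z′∈I))

    fixed-ζ : ∀ I → z ∈ ideal I ⇔ z ∈ ideal (ζ I)
    fixed-ζ I = mk⇔ (fixed-∈⇒′-∉ I)
      λ z′∉I → decidable-stable (decide (z ∈ ideal I)) (z′∉I ∘ fixed-∉⇒′-∈ I)

    -- A prime ideal contains exactly one of `z` and `z ′`. Were `z` in `J` but not in `I`, then
    -- `z ′` would pass from `I` to `J` and join `z` there.
    fixed-≤ : ∀ I J → I ≤ᴾ J → z ∈ ideal I ⇔ z ∈ ideal J
    fixed-≤ I J I⊆J = mk⇔ I⊆J λ z∈J →
      decidable-stable (decide (z ∈ ideal I))
        (λ z∉I → fixed-∈⇒′-∉ J z∈J (I⊆J (fixed-∉⇒′-∈ I z∉I)))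

    fixed-~ : ∀ {I J} → I ~ J → z ∈ ideal I ⇔ z ∈ ideal J
    fixed-~ = gfold {R = _≤ᴾ_} ⇔-isEquivalence (λ I → z ∈ ideal I) λ {I} {J} → fixed-≤ I J

  -- If `b` is not `𝟏`, the ideal below it extends to a prime ideal; this contains `a` as well,
  -- hence `𝟏`.
  cover⇒≈𝟏 : ∀ {a b} → 𝟏 ≤ a ∨ b → (∀ I → a ∈ ideal I) → b ≈ 𝟏
  cover⇒≈𝟏 {a} {b} 𝟏≤a∨b a∈ with decide (Lift c (𝟏 ≤ b))
  ... | yes (lift 𝟏≤b) = 𝟏≤⇒≈𝟏 𝟏≤b
  ... | no 𝟏≰b with J , ↓b⊆J ← extendToPrime (↓-isIdeal b) 𝟏≰b =
    ⊥-elim (proper J (downClosed J 𝟏≤a∨b (∨-closed J (a∈ J) (↓b⊆J (lift ≤-refl)))))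

  -- From a covering order component to simplicity.

  module _ {Q : Pred P (suc (c ⊔ ℓ))} (isComponent : IsOrderComponent Q)
           (covers : ∀ J → J ∈ Q ∪ ζ[ Q ]) where
    open IsOrderComponent isComponent

    private
      I₀ : P
      I₀ = proj₁ nonempty

    fixed-constant : ∀ {z} → z ≈ z ′ * → ∀ J → z ∈ ideal I₀ ⇔ z ∈ ideal J
    fixed-constant z≈z′* J with covers J
    ... | inj₁ J∈Q = fixed-~ z≈z′* (connected (proj₂ nonempty) J∈Q)
    ... | inj₂ (I , I∈Q , J⊆ζI , ζI⊆J) =
      ⇔-trans (fixed-~ z≈z′* (connected (proj₂ nonempty) I∈Q))
        (⇔-trans (fixed-ζ z≈z′* I) (mk⇔ ζI⊆J J⊆ζI))

    -- By `fixed-constant`, either `z` or `z ′` lies in all prime ideals; the other of the two is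
    -- then `𝟏` by `cover⇒≈𝟏`.
    fixed-trivial : ∀ {z} → z ≈ z ′ * → z ≈ 𝟏 ⊎ z ≈ 𝟎
    fixed-trivial {z} z≈z′* with decide (z ∈ ideal I₀)
    ... | yes z∈I₀ = inj₂ (≤𝟎⇒≈𝟎 (≤-trans x≤x′′ (≤-trans (′-antitone 𝟏≤z′) 𝟏′≤𝟎)))
      where
      𝟏≤z′ : 𝟏 ≤ z ′
      𝟏≤z′ = ≤-reflexive (sym (cover⇒≈𝟏 (fixed⇒cover z≈z′*)
        (λ J → Equivalence.to (fixed-constant z≈z′* J) z∈I₀)))
    ... | no z∉I₀ = inj₁ (cover⇒≈𝟏 (≤-trans (fixed⇒cover z≈z′*) ∨-swap-≤)
        (λ J → fixed-∉⇒′-∈ z≈z′* J (z∉I₀ ∘ Equivalence.from (fixed-constant z≈z′* J))))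

    component⇒simple : ∀ {n} → L ∈𝐌 n → IsSimple L
    component⇒simple {n} L∈𝐌 = record
      { nontrivial = λ trivial →
          proper I₀ (downClosed I₀ (≤-reflexive (trivial 𝟏 𝟎)) (𝟎-closed I₀))
      ; onlyCongruences = onlyCongruences
      }
      where
      open _∈𝐌_ L∈𝐌

      onlyCongruences : (θ : Rel Carrier (c ⊔ ℓ)) → IsCongruence L θ →
                        (θ ⇒ _≈_) ⊎ (∀ x y → θ x y)
      onlyCongruences θ isCongruence with decide (∃[ x ] (θ x 𝟏 × ¬ x ≈ 𝟏))
      ... | no ∄x = inj₁ (regular⇒identity regular λ {x} θx𝟏 →
          lower (decidable-stable (decide (Lift c (x ≈ 𝟏)))
            (λ x≉𝟏 → ∄x (x , θx𝟏 , x≉𝟏 ∘ lift))))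
        where open CongruenceProperties isCongruence
      -- The fixed point built from `x` stays in the class of `𝟏` and lies below `x`, so it is not
      -- `𝟏`. Hence it is `𝟎`, and `θ` relates `𝟎` to `𝟏`.
      ... | yes (x , θx𝟏 , x≉𝟏) with fixed-trivial (range x)
      ...   | inj₁ ≈𝟏 = contradiction
                (𝟏≤⇒≈𝟏 (≤-trans (≤-reflexive (sym ≈𝟏)) (iter′*-∧′*-≤ n))) x≉𝟏
      ...   | inj₂ ≈𝟎 = inj₂ (total (IsEquivalence.trans isEquivalenceᶿ
                (reflexiveᶿ (sym ≈𝟎)) (iter′*-𝟏-class n (∧′*-𝟏-class θx𝟏))))
        where
        open IsCongruence isCongruence
        open CongruenceProperties isCongruence

  -- Walks in the dual space that mirror the iterates of `′*`.

  data Steps (I : P) : ℕ → P → Set (suc (c ⊔ ℓ)) where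
    stay : Steps I 0 I
    step : ∀ {k J K} → Steps I k J → ζ J ≤ᴾ K → Steps I (ℕ.suc k) K

  -- Each step exchanges the two alternatives, since `ζ` maps paths to paths and `ζ (ζ I)` is
  -- connected to `I`.
  steps-~ : ∀ {I k J} → Steps I k J → J ~ I ⊎ J ~ ζ I
  steps-~ stay = inj₁ (EqClosure.reflexive _≤ᴾ_)
  steps-~ {I} {J = K} (step {J = J} steps ζJ⊆K) =
    Sum.swap (Sum.map (K~ζ ∘ ζ-~) (λ J~ζI → K~ζ (~-trans (ζ-~ J~ζI) (~-sym (~-ζζ I))))
      (steps-~ steps))
    where
    K~ζ : ∀ {H} → ζ J ~ H → K ~ H
    K~ζ = ~-trans (~-sym (≤⇒~ (ζ J) K ζJ⊆K))

  module _ {K : Pred Carrier (c ⊔ ℓ)} (isIdealK : IsIdeal K) where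
    open IsIdeal isIdealK using ()
      renaming (𝟎-closed to 𝟎∈K; ∨-closed to ∨-closedᴷ)

    -- Closing the image downwards is enough to get an ideal: by monotonicity the values at `x` and
    -- `y` both lie below the value at `x ∨ y`.
    ′*-image : Pred Carrier (c ⊔ ℓ)
    ′*-image y = ∃[ x ] (x ∈ K × y ≤ x ′ *)

    ′*-image-isIdeal : IsIdeal ′*-image
    ′*-image-isIdeal = record
      { downClosed = λ a≤b (x , x∈K , b≤x′*) → x , x∈K , ≤-trans a≤b b≤x′*
      ; 𝟎-closed   = 𝟎 , 𝟎∈K , 𝟎-≤ _
      ; ∨-closed   = λ (x , x∈K , a≤x′*) (y , y∈K , b≤y′*) →
          x ∨ y , ∨-closedᴷ x∈K y∈K ,
          ∨-least (≤-trans a≤x′* (′*-monotone (x≤x∨y x y)))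
                  (≤-trans b≤y′* (′*-monotone (y≤x∨y x y)))
      }

    -- If 𝟏 ≤ a ∨ x with a′ ∉ J and x ∈ K, then a′ ≤ x′*, which lies in J.
    extendStep : ∀ J → ′*-image ⊆ ideal J → ∃[ H ] (ζ J ≤ᴾ H × K ⊆ ideal H)
    extendStep J image⊆J =
      let H , ζJ∨K⊆H = extendToPrime (∨ᴵ-isIdeal ζJ-isIdeal isIdealK) proper′
      in H , (λ a∈ζJ → ζJ∨K⊆H (⊆-∨ᴵˡ ζJ-isIdeal isIdealK a∈ζJ))
           , (λ x∈K → ζJ∨K⊆H (⊆-∨ᴵʳ ζJ-isIdeal isIdealK x∈K))
      where
      ζJ-isIdeal : IsIdeal (ideal (ζ J))
      ζJ-isIdeal = prime⇒isIdeal (ζ J)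

      proper′ : 𝟏 ∉ ideal (ζ J) ∨ᴵ K
      proper′ (a , x , a′∉J , x∈K , 𝟏≤a∨x) = a′∉J (image⊆J (x , x∈K , disjoint⇒≤*
        (≤-trans ∧-swap-≤ (≤-trans (≤-reflexive (sym (′-deMorgan a x)))
          (≤-trans (′-antitone 𝟏≤a∨x) 𝟏′≤𝟎)))))

  -- Induction on `k` for arbitrary ideals, since the recursive call concerns `′*-image`, which need
  -- not be prime. That call peels off the innermost `′*` and supplies all steps but the last;
  -- `extendStep` supplies the last.
  extendSteps : ∀ k {K} → IsIdeal K → ∀ I → (∀ {x} → x ∈ K → iter′* k x ∈ ideal I) →
                ∃[ J ] (Steps I k J × K ⊆ ideal J)
  extendSteps ℕ.zero    isIdealK I K⊆I = I , stay , K⊆I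
  extendSteps (ℕ.suc k) isIdealK I iterK⊆I
    with J , steps , image⊆J ← extendSteps k (′*-image-isIdeal isIdealK) I
           (λ (x , x∈K , y≤x′*) → downClosed I (iter′*-monotone k y≤x′*)
             (≡.subst (_∈ ideal I) (iter′*-shift k x) (iterK⊆I x∈K)))
    with H , ζJ⊆H , K⊆H ← extendStep isIdealK J image⊆J
    = H , step steps ζJ⊆H , K⊆H

  -- From simplicity to a covering order component.

  module _ {n} (L∈𝐌 : L ∈𝐌 n) (simple : IsSimple L) where

    -- The meet of the two iterates lies below `iter′* n (x ∧ x ′ *)`, which is `𝟎` by simplicity,
    -- and `I` is prime.
    iter′*-∈ : ∀ {x} → ¬ x ≈ 𝟏 → ∀ I → iter′* n x ∈ ideal I ⊎ iter′* (ℕ.suc n) x ∈ ideal I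
    iter′*-∈ {x} x≉𝟏 I = prime I (downClosed I
      (≤-trans (∧-monotonic ≤-refl (≤-reflexive-≡ (iter′*-shift n x)))
        (≤-trans (iter′*-∧ n) (≤-reflexive (∧′*-simple simple L∈𝐌 x≉𝟏))))
      (𝟎-closed I))
      where
      ≤-reflexive-≡ : ∀ {a b} → a ≡ b → a ≤ b
      ≤-reflexive-≡ ≡.refl = ≤-refl

    -- If `n` fails at some `x` in `K`, it fails at `x ∨ y` for every `y` in `K`. As `K` is proper,
    -- `x ∨ y` is not `𝟏`, so `ℕ.suc n` works at `x ∨ y` and therefore at `y`.
    iter′*-uniform : ∀ I K → ∃[ k ] (∀ {x} → x ∈ ideal K → iter′* k x ∈ ideal I)
    iter′*-uniform I K with decide (∃[ x ] (x ∈ ideal K × iter′* n x ∉ ideal I))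
    ... | no ∄x = n , λ {x} x∈K →
      decidable-stable (decide _) λ iter∉I → ∄x (x , x∈K , iter∉I)
    ... | yes (x , x∈K , iter∉I) = ℕ.suc n , λ {y} y∈K →
      [ (λ iter∈I → contradiction
          (downClosed I (iter′*-monotone n (x≤x∨y x y)) iter∈I) iter∉I)
      , downClosed I (iter′*-monotone (ℕ.suc n) (y≤x∨y x y))
      ]′ (iter′*-∈ (∈⇒≉𝟏 (∨-closed K x∈K y∈K)) I)
      where
      ∈⇒≉𝟏 : ∀ {a} → a ∈ ideal K → ¬ a ≈ 𝟏
      ∈⇒≉𝟏 a∈K a≈𝟏 = proper K (downClosed K (≤-reflexive (sym a≈𝟏)) a∈K)

    simple⇒~ : ∀ I K → K ~ I ⊎ K ~ ζ I
    simple⇒~ I K with k , iterK⊆I ← iter′*-uniform I K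
      with J , steps , K⊆J ← extendSteps k (prime⇒isIdeal K) I iterK⊆I =
      Sum.map (~-trans (≤⇒~ K J K⊆J)) (~-trans (≤⇒~ K J K⊆J)) (steps-~ steps)

    simple⇒covers : ∀ I J → J ∈ component I ∪ ζ[ component I ]
    simple⇒covers I J with simple⇒~ I J
    ... | inj₁ J~I  = inj₁ (~-sym J~I)
    ... | inj₂ J~ζI =
      -- Applying `ζ` to the path from `J` to `ζ I` puts `ζ J` in the component of `I`, and `J` is
      -- the image of `ζ J`.
      inj₂ (ζ J , ~-trans (~-ζζ I) (~-sym (ζ-~ J~ζI)) , ζ-involutive J)

    -- A component needs a point to start from: non-triviality makes the ideal below `𝟎` proper, so
    -- some prime ideal exists.
    simple⇒prime : P
    simple⇒prime = proj₁ (extendToPrime (↓-isIdeal 𝟎) λ (lift 𝟏≤𝟎) →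
      IsSimple.nontrivial simple λ x y → trans (collapse 𝟏≤𝟎 x) (sym (collapse 𝟏≤𝟎 y)))
      where
      collapse : 𝟏 ≤ 𝟎 → ∀ x → x ≈ 𝟎
      collapse 𝟏≤𝟎 x = ≤𝟎⇒≈𝟎 (≤-trans (≤-𝟏 x) 𝟏≤𝟎)

    simple⇒component : ∃[ Q ] (IsOrderComponent Q × U ≐ Q ∪ ζ[ Q ])
    simple⇒component =
      component simple⇒prime , component-isOrderComponent simple⇒prime ,
      (λ {J} _ → simple⇒covers simple⇒prime J) , _

theorem4p2 : ∀ {c ℓ}
    (em : ExcludedMiddle (suc (c ⊔ ℓ)))
    (zorn : Zorn (suc (c ⊔ ℓ)) (c ⊔ ℓ) (c ⊔ ℓ) (suc (c ⊔ ℓ)))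
    (n : ℕ) (L : PseudocomplementedDeMorganAlgebra c ℓ) → L ∈𝐌 n →
    let open Dual em L in
    IsSimple L ⇔ (∃[ Q ] (IsOrderComponent Q × U ≐ Q ∪ ζ[ Q ]))
theorem4p2 em zorn n L L∈𝐌 = mk⇔ (simple⇒component L∈𝐌)
  λ (Q , isComponent , U⊆Q∪ζQ , _) → component⇒simple isComponent (λ J → U⊆Q∪ζQ _) L∈𝐌
  where open DualProperties em zorn L
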